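{- For every even integer $n\ge 4$, the cycle $C_n$ on $n$ vertices is critically $1$-uniform.
   Context: $[k]=\{1,\dots,k\}$ and $\chi(G)$ is the chromatic number of a graph $G=(V,E)$. For a proper coloring $c:V\to[\chi(G)]$, a determining set for $(G,c)$ is a set $S\subseteq V$ such that for every proper coloring $c':V\to[\chi(G)]$ of $G$, if $c'|_S=c|_S$ then $c'=c$ on all of $V$. A critical set for $(G,c)$ is a determining set for $(G,c)$ that is minimal under inclusion. $G$ is critically $k$-uniform if for every proper coloring $c:V\to[\chi(G)]$, every critical set $S$ for $(G,c)$ satisfies $|S|=k$. -}

module Defs where

open import Data.Fin using (Fin; toℕ)
open import Data.Fin.Subset using (Subset; _∈_; _⊆_; ∣_∣)
open import Data.Nat using (ℕ; suc; _≤_; _≟_)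
open import Data.Nat.Properties using (≤-antisym; <⇒≤; <⇒≢; 1+n≢n)
open import Data.Product using (∃-syntax; _×_; _,_)
open import Data.Sum using (_⊎_; inj₁; inj₂; swap)
open import Level using (0ℓ)
open import Relation.Binary using (Rel; Symmetric; Irreflexive; Decidable)
open import Relation.Binary.PropositionalEquality
  using (_≡_; _≢_; _≗_; refl; sym; trans; cong)
open import Relation.Nullary using (¬_; _×-dec_; _⊎-dec_)

-- Finite simple graphs with vertex set Fin n.
record Graph (n : ℕ) : Set₁ where
  field
    Adj    : Rel (Fin n) 0ℓ
    symm   : Symmetric Adj
    irrefl : Irreflexive _≡_ Adj
    adj?   : Decidable Adj

Proper : ∀ {n k} → Graph n → (Fin n → Fin k) → Set
Proper G c = ∀ {u v} → Graph.Adj G u v → c u ≢ c v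

Colorable : ∀ {n} → Graph n → ℕ → Set
Colorable {n} G k = ∃[ c ] Proper {n} {k} G c

IsChromaticNumber : ∀ {n} → Graph n → ℕ → Set
IsChromaticNumber G k = Colorable G k × (∀ {j} → Colorable G j → k ≤ j)

chromaticNumber-unique : ∀ {n} (G : Graph n) {k l} →
  IsChromaticNumber G k → IsChromaticNumber G l → k ≡ l
chromaticNumber-unique G (ck , mink) (cl , minl) = ≤-antisym (mink cl) (minl ck)

Determining : ∀ {n k} → Graph n → (Fin n → Fin k) → Subset n → Set
Determining {n} {k} G c S =
  ∀ (c′ : Fin n → Fin k) → Proper G c′ →
  (∀ {v} → v ∈ S → c′ v ≡ c v) → c′ ≗ c

Critical : ∀ {n k} → Graph n → (Fin n → Fin k) → Subset n → Set
Critical G c S =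
  Determining G c S × (∀ T → T ⊆ S → Determining G c T → T ≡ S)

-- The chromatic number is introduced by definite description: it is
-- asserted to exist, and it is unique by chromaticNumber-unique.
CriticallyUniform : ∀ {n} → Graph n → ℕ → Set
CriticallyUniform {n} G k =
  ∃[ χ ] IsChromaticNumber G χ ×
    (∀ (c : Fin n → Fin χ) → Proper G c → ∀ S → Critical G c S → ∣ S ∣ ≡ k)

-- j is the cyclic successor of i, that is, j = i + 1 modulo n.
Next : ∀ {n} → Rel (Fin n) 0ℓ
Next {n} i j = toℕ j ≡ suc (toℕ i) ⊎ (suc (toℕ i) ≡ n × toℕ j ≡ 0)

cycle : ∀ n → 3 ≤ n → Graph n
cycle n 3≤n = record
  { Adj    = λ i j → Next i j ⊎ Next j i
  ; symm   = swap
  ; irrefl = λ { refl (inj₁ p) → next-irrefl p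
               ; refl (inj₂ p) → next-irrefl p }
  ; adj?   = λ i j → next? i j ⊎-dec next? j i
  }
  where
  next-irrefl : ∀ {i} → ¬ Next {n} i i
  next-irrefl (inj₁ i≡1+i)         = 1+n≢n (sym i≡1+i)
  next-irrefl (inj₂ (1+i≡n , i≡0)) =
    <⇒≢ (<⇒≤ 3≤n) (trans (cong suc (sym i≡0)) 1+i≡n)

  next? : Decidable (Next {n})
  next? i j = (toℕ j ≟ suc (toℕ i)) ⊎-dec ((suc (toℕ i) ≟ n) ×-dec (toℕ j ≟ 0))

{-# OPTIONS --safe #-}
module Submission where

open import Defs
open import Data.Empty using (⊥-elim)
open import Data.Fin using (Fin; zero; suc; toℕ; inject₁; opposite)
open import Data.Fin.Induction using (<-weakInduction)
open import Data.Fin.Properties using (opposite-involutive; toℕ-inject₁)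
open import Data.Fin.Subset using (_∈_; Nonempty; ⁅_⁆; ∣_∣)
open import Data.Fin.Subset.Properties using (nonempty?; x∈⁅x⁆; x∈⁅y⁆⇒x≡y; ∣⁅x⁆∣≡1)
open import Data.Nat using (ℕ; zero; suc; _*_; _≤_; z≤n; s≤s)
open import Data.Nat.Divisibility using (_∣_; divides)
open import Data.Nat.Properties using (<⇒≤)
open import Data.Product using (_,_)
open import Data.Sum using (inj₁; inj₂)
open import Function using (_∘_)
open import Relation.Binary.PropositionalEquality
  using (_≡_; _≢_; _≗_; refl; sym; trans; cong; subst; ≢-sym)
open import Relation.Nullary using (yes; no)

-- A proper 2-colouring alternates around the cycle, so its value at any single
-- vertex determines it, while swapping the two colours shows that the empty set
-- does not.  Hence the critical sets are exactly the singletons.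

-- On `Fin 2` the order reversal `opposite` is the swap of the two colours, so it has no fixed
-- point.
opposite≢ : (x : Fin 2) → opposite x ≢ x
opposite≢ zero       ()
opposite≢ (suc zero) ()

≢⇒≡ : {x y z : Fin 2} → x ≢ z → y ≢ z → x ≡ y
≢⇒≡ {zero}     {zero}     _   _   = refl
≢⇒≡ {suc zero} {suc zero} _   _   = refl
≢⇒≡ {zero}     {suc zero} {zero}     x≢z _   = ⊥-elim (x≢z refl)
≢⇒≡ {zero}     {suc zero} {suc zero} _   y≢z = ⊥-elim (y≢z refl)
≢⇒≡ {suc zero} {zero}     {zero}     _   y≢z = ⊥-elim (y≢z refl)
≢⇒≡ {suc zero} {zero}     {suc zero} x≢z _   = ⊥-elim (x≢z refl)

opposite-injective : ∀ {k} {x y : Fin k} → opposite x ≡ opposite y → x ≡ y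
opposite-injective {x = x} {y} eq =
  trans (sym (opposite-involutive x)) (trans (cong opposite eq) (opposite-involutive y))

-- Parity as a colour; recursing through `opposite` makes the colour change along an edge from `i`
-- to `i + 1` definitional.
alternating : ℕ → Fin 2
alternating zero    = zero
alternating (suc k) = opposite (alternating k)

alternating-even : ∀ {n} → 2 ∣ n → alternating n ≡ zero
alternating-even (divides q refl) = go q
  where
  go : ∀ q → alternating (q * 2) ≡ zero
  go zero    = refl
  go (suc q) = trans (opposite-involutive (alternating (q * 2))) (go q)

-- The closing edge is where evenness enters: the swap of the last vertex's colour is
-- `alternating n`, which must equal the colour of vertex zero.
alternating-next : ∀ {n} → 2 ∣ n → {i j : Fin n} → Next i j →
  alternating (toℕ j) ≡ opposite (alternating (toℕ i))
alternating-next 2∣n (inj₁ j≡1+i)         = cong alternating j≡1+i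
alternating-next 2∣n (inj₂ (1+i≡n , j≡0)) =
  trans (cong alternating j≡0)
    (trans (sym (alternating-even 2∣n)) (cong alternating (sym 1+i≡n)))

alternating-proper : ∀ {n} (3≤n : 3 ≤ n) → 2 ∣ n →
  Proper (cycle n 3≤n) (alternating ∘ toℕ)
alternating-proper 3≤n 2∣n {u} (inj₁ next) eq =
  opposite≢ (alternating (toℕ u)) (trans (sym (alternating-next 2∣n next)) (sym eq))
alternating-proper 3≤n 2∣n {v = v} (inj₂ next) eq =
  opposite≢ (alternating (toℕ v)) (trans (sym (alternating-next 2∣n next)) eq)

-- Vertex zero rules out an empty palette, and the edge between vertices zero and one rules out a
-- single colour.
cycle-colorable⇒2≤ : ∀ {n} (3≤n : 3 ≤ n) {k} → Colorable (cycle n 3≤n) k → 2 ≤ k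
cycle-colorable⇒2≤ (s≤s _)       {zero}        (c , _) with () ← c zero
cycle-colorable⇒2≤ (s≤s (s≤s _)) {suc zero}    (c , proper)
  with c zero | c (suc zero) | proper {zero} {suc zero} (inj₁ (inj₁ refl))
... | zero | zero | 0≢0 = ⊥-elim (0≢0 refl)
cycle-colorable⇒2≤ _             {suc (suc _)} _ = s≤s (s≤s z≤n)

-- Both colours at `v` avoid the common colour at `u`, and only one colour remains.
adjacent-agree : ∀ {n} (G : Graph n) {c c′ : Fin n → Fin 2} →
  Proper G c → Proper G c′ →
  ∀ {u v} → Graph.Adj G u v → c u ≡ c′ u → c v ≡ c′ v
adjacent-agree G {c′ = c′} proper proper′ {v = v} adj cu≡c′u =
  ≢⇒≡ (≢-sym (proper adj)) (subst (c′ v ≢_) (sym cu≡c′u) (≢-sym (proper′ adj)))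

-- Agreement spreads along the edges joining `i` and `i + 1`: first down from `v` to zero, then from
-- zero up to every vertex.
cycle-agree : ∀ {n} (3≤n : 3 ≤ n) {c c′ : Fin n → Fin 2} →
  Proper (cycle n 3≤n) c → Proper (cycle n 3≤n) c′ →
  ∀ v → c v ≡ c′ v → c ≗ c′
cycle-agree {suc m} 3≤n {c} {c′} proper proper′ v eq = fromZero (toZero v eq)
  where
  G = cycle (suc m) 3≤n

  step : (i : Fin m) → Graph.Adj G (inject₁ i) (suc i)
  step i = inj₁ (inj₁ (cong suc (sym (toℕ-inject₁ i))))

  agree : ∀ {u v} → Graph.Adj G u v → c u ≡ c′ u → c v ≡ c′ v
  agree = adjacent-agree G proper proper′

  toZero : ∀ v → c v ≡ c′ v → c zero ≡ c′ zero
  -- The motive is an implication, so the inductive step moves agreement from `suc i` back to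
  -- `inject₁ i` and then applies the hypothesis there.
  toZero = <-weakInduction (λ v → c v ≡ c′ v → c zero ≡ c′ zero) (λ eq → eq)
    (λ i ih → ih ∘ agree (Graph.symm G (step i)))

  fromZero : c zero ≡ c′ zero → c ≗ c′
  fromZero eq = <-weakInduction (λ v → c v ≡ c′ v) eq (λ i → agree (step i))

singleton-determining : ∀ {n} (3≤n : 3 ≤ n) {c : Fin n → Fin 2} →
  Proper (cycle n 3≤n) c → ∀ v → Determining (cycle n 3≤n) c ⁅ v ⁆
singleton-determining 3≤n proper v c′ proper′ agree =
  cycle-agree 3≤n proper′ proper v (agree (x∈⁅x⁆ v))

determining⇒nonempty : ∀ {n} (G : Graph (suc n)) {c : Fin (suc n) → Fin 2} →
  Proper G c → ∀ {S} → Determining G c S → Nonempty S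
determining⇒nonempty G {c} proper {S} det with nonempty? S
... | yes nonempty = nonempty
-- The swapped colouring agrees vacuously with `c` on an empty set, yet differs from it at vertex
-- zero.
... | no  empty    = ⊥-elim (opposite≢ (c zero)
  (det (opposite ∘ c) (λ adj → proper adj ∘ opposite-injective)
    (λ v∈S → ⊥-elim (empty (_ , v∈S))) zero))

-- Any `v` in `S` already gives a determining singleton inside `S`, so minimality collapses `S` to
-- it.
cycle-critical⇒∣S∣≡1 : ∀ {n} (3≤n : 3 ≤ n) {c : Fin n → Fin 2} →
  Proper (cycle n 3≤n) c → ∀ {S} → Critical (cycle n 3≤n) c S → ∣ S ∣ ≡ 1
cycle-critical⇒∣S∣≡1 {suc m} 3≤n proper {S} (det , minimal)
  with v , v∈S ← determining⇒nonempty (cycle (suc m) 3≤n) proper det =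
  trans (cong ∣_∣ (sym ⁅v⁆≡S)) (∣⁅x⁆∣≡1 v)
  where
  ⁅v⁆≡S : ⁅ v ⁆ ≡ S
  ⁅v⁆≡S = minimal ⁅ v ⁆
    (λ u∈⁅v⁆ → subst (_∈ S) (sym (x∈⁅y⁆⇒x≡y v u∈⁅v⁆)) v∈S)
    (singleton-determining 3≤n proper v)

corollary5 : (n : ℕ) (4≤n : 4 ≤ n) → 2 ∣ n → CriticallyUniform (cycle n (<⇒≤ 4≤n)) 1
corollary5 n 4≤n 2∣n =
  -- The chromatic number: the parity colouring bounds it above, the edge argument below.
  2 ,
  ((alternating ∘ toℕ , alternating-proper 3≤n 2∣n) , cycle-colorable⇒2≤ 3≤n) ,
  (λ c proper S → cycle-critical⇒∣S∣≡1 3≤n proper)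
  where
  3≤n = <⇒≤ 4≤n
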